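{- Let $\phi(q)=\sum_{n=0}^\infty \frac{q^{n^2}}{(-q^2;q^2)_n}$ be Ramanujan's third order mock theta function, and for $n\ge 1$ let $p_{do}(n)$ denote the number of partitions of $n$ into distinct parts with the smallest part being odd. Then \[ (-q;q)_\infty\,\phi(-q)=1+\sum_{n=1}^\infty p_{do}(n)q^n+\sum_{k=1}^\infty (-1)^k q^{k^2}. \]
   Context: Notation: $(a;q)_n=(1-a)(1-aq)\cdots(1-aq^{n-1})$ (with $(a;q)_0=1$) and $(a;q)_\infty=\prod_{n\ge 0}(1-aq^n)$, $|q|<1$ (equivalently, identities of formal power series in $q$). -}

module Defs where

open import Data.Nat as ℕ using (ℕ; zero; suc; _∸_; _≡ᵇ_; _%_)
open import Data.Integer as ℤ using (ℤ; 0ℤ; 1ℤ; -_; _+_; _*_)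
open import Data.Bool using (Bool; true; false; _∧_; if_then_else_)
open import Data.List as List using (List; []; _∷_; foldr; map; zipWith; upTo; length; filterᵇ)

-- Formal power series in q with integer coefficients, as coefficient
-- sequences:  f  represents  Σ_n f n · q^n.

PS : Set
PS = ℕ → ℤ

sumℤ : List ℤ → ℤ
sumℤ = foldr _+_ 0ℤ

sgn : ℕ → ℤ
sgn zero    = 1ℤ
sgn (suc n) = - sgn n

const : ℤ → PS
const c zero    = c
const c (suc _) = 0ℤ

mono : ℤ → ℕ → PS
mono c k n = if n ≡ᵇ k then c else 0ℤ

infixl 6 _⊕_
infixl 7 _⊛_

_⊕_ : PS → PS → PS
(f ⊕ g) n = f n + g n

_⊛_ : PS → PS → PS
(f ⊛ g) n = sumℤ (map (λ i → f i * g (n ∸ i)) (upTo (suc n)))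

prodPS : List PS → PS
prodPS = foldr _⊛_ (const 1ℤ)

-- Multiplicative inverse of a series with constant term 1:
-- b₀ = 1,  b_{n+1} = - Σ_{i=1}^{n+1} a_i b_{n+1-i}.
-- invRev a n = b_n ∷ b_{n-1} ∷ … ∷ b_0
invRev : PS → ℕ → List ℤ
invRev a zero    = 1ℤ ∷ []
invRev a (suc n) =
  let bs = invRev a n in
  (- sumℤ (zipWith _*_ (map (λ i → a (suc i)) (upTo (suc n))) bs)) ∷ bs

inv : PS → PS
inv a n with invRev a n
... | []    = 0ℤ
... | b ∷ _ = b

negVar : PS → PS
negVar f n = sgn n * f n

-- q-Pochhammer symbols with a = c·q^s and base q^t:
--   (c q^s ; q^t)_n = ∏_{j<n} (1 - c q^{s + t j})

poch : ℤ → ℕ → ℕ → ℕ → PS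
poch c s t n = prodPS (map (λ j → const 1ℤ ⊕ mono (- c) (s ℕ.+ t ℕ.* j)) (upTo n))

-- (c q^s ; q^t)_∞ for s ≥ 1, t ≥ 1: the j-th factor is 1 + O(q^{j+1}),
-- so the coefficient of q^N of the infinite product equals that of the
-- finite product over j < N.
pochInf : ℤ → ℕ → ℕ → PS
pochInf c s t N = poch c s t N N

-- Infinite sum Σ_{k≥0} f k of series where f k = O(q^k): the coefficient of
-- q^N only receives contributions from k ≤ N.
infSum : (ℕ → PS) → PS
infSum f N = sumℤ (map (λ k → f k N) (upTo (suc N)))

-- Ramanujan's third order mock theta function
--   φ(q) = Σ_{n≥0} q^{n²} / (-q²;q²)_n
-- (the n-th term is O(q^{n²}) and n² ≥ n).

phi : PS
phi = infSum (λ n → mono 1ℤ (n ℕ.* n) ⊛ inv (poch (- 1ℤ) 2 2 n))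

-- p_do(n): number of partitions of n into distinct parts whose smallest
-- part is odd.  A partition of n into distinct parts is the same as a
-- finite set of positive integers (each ≤ n) with sum n; we enumerate the
-- subsets of [1..n] as increasing sublists, so the head is the smallest part.

sublists : List ℕ → List (List ℕ)
sublists []       = [] ∷ []
sublists (x ∷ xs) = let r = sublists xs in map (x ∷_) r List.++ r

sumℕ : List ℕ → ℕ
sumℕ = foldr ℕ._+_ 0

smallestOdd : List ℕ → Bool
smallestOdd []      = false
smallestOdd (x ∷ _) = x % 2 ≡ᵇ 1

isDistinctOddPartition : ℕ → List ℕ → Bool
isDistinctOddPartition n ps = (sumℕ ps ≡ᵇ n) ∧ smallestOdd ps

p-do : ℕ → ℕ
p-do n = length (filterᵇ (isDistinctOddPartition n) (sublists (map suc (upTo n))))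

pdoSeries : PS
pdoSeries zero    = 0ℤ
pdoSeries (suc n) = ℤ.+ p-do (suc n)

-- Σ_{k≥1} (-1)^k q^{k²}   (k-th term indexed from k = 0 as (k+1)),
-- term is O(q^{(k+1)²}), (k+1)² ≥ k.
thetaTail : PS
thetaTail = infSum (λ k → mono (sgn (suc k)) (suc k ℕ.* suc k))

{-# OPTIONS --safe #-}

-- Put E k = Σ_n (-1)ⁿ q^{n²} (-q^{2k+2n+2};q²)_∞, so that the left-hand side is
-- (-q;q²)_∞ E 0.  Peeling off the first factor of every product gives
--   (1 + q^{2k+1}) E k = E (k+1) + q^{2k+1} (-q^{2k+2};q²)_∞,
-- hence L k = (-q^{2k+1};q²)_∞ E k satisfies
--   L k = L (k+1) + q^{2k+1} (-q^{2k+2};q)_∞.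
-- Telescoping, L 0 is Σ_k q^{2k+1} (-q^{2k+2};q)_∞, which counts distinct partitions
-- by their odd smallest part, plus lim L k = Σ_n (-1)ⁿ q^{n²}.
-- Coefficients of q^N are compared in ℤ[[q]] / (q^{N+1}), where all products are finite.

module Submission where

open import Defs
open import Data.Nat using (ℕ)
open import Data.Integer using (1ℤ; -_)
open import Relation.Binary.PropositionalEquality using (_≡_)

open import Algebra.Bundles using (CommutativeSemiring)
open import Algebra.Structures.Biased using (isCommutativeSemiringˡ)
open import Data.Bool using (true; false; if_then_else_; not)
import Data.Integer.Properties as ℤₚ
open import Data.Integer.Tactic.RingSolver using () renaming (solve-∀ to solveℤ-∀)
open import Data.List using (List; []; _∷_; map; upTo; foldr; filterᵇ; length; zipWith; _∷ʳ_; _++_)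
import Data.List.Properties as Listₚ
open import Data.Nat as ℕ using (zero; suc; _≤_; _<_; z≤n; s≤s; _≡ᵇ_; _%_; _∸_)
import Data.Nat.Properties as ℕₚ
open import Data.Nat.Tactic.RingSolver using (solve-∀)
open import Data.Product using (_,_)
open import Function using (_∘_)
open import Level using (0ℓ)
open import Relation.Binary.PropositionalEquality as ≡
  using (_≢_; _≗_; cong; cong₂; module ≡-Reasoning)
open import Relation.Binary.Structures using (IsEquivalence)
open import Relation.Nullary using (yes; no; contradiction)

-- Parity, and finite products in a commutative semiring.

odd-suc : ∀ s → (suc s % 2 ≡ᵇ 1) ≡ not (s % 2 ≡ᵇ 1)
odd-suc zero          = ≡.refl
odd-suc (suc zero)    = ≡.refl
odd-suc (suc (suc s)) = odd-suc s

module Products {c ℓ} (R : CommutativeSemiring c ℓ)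
  (p : ℕ → CommutativeSemiring.Carrier R) where

  open CommutativeSemiring R
  open import Algebra.Solver.Ring.NaturalCoefficients.Default R
  open import Relation.Binary.Reasoning.Setoid setoid

  -- ∏_{j<m} (1 + p (s + t j))
  ∏ : ℕ → ℕ → ℕ → Carrier
  ∏ t s zero    = 1#
  ∏ t s (suc m) = ∏ t (t ℕ.+ s) m + p s * ∏ t (t ℕ.+ s) m

  -- With p i = qⁱ, the generating function of the nonempty subsets of {s, ..., s + m - 1} whose
  -- least element is odd, sorted by that element: `p s` marks it and the product chooses the larger
  -- ones.
  oddLeast : ℕ → ℕ → Carrier
  oddLeast s zero    = 0#
  oddLeast s (suc m) =
    (if s % 2 ≡ᵇ 1 then p s * ∏ 1 (suc s) m else 0#) + oddLeast (suc s) m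

  -- The even start `suc s` contributes nothing. Advancing by two keeps pace with the products of
  -- step 2 in the telescoping.
  oddLeast-step : ∀ s m → (s % 2 ≡ᵇ 1) ≡ true →
    oddLeast s (suc m ℕ.+ suc m) ≈
    p s * ∏ 1 (suc s) (suc (m ℕ.+ m)) + oddLeast (2 ℕ.+ s) (m ℕ.+ m)
  oddLeast-step s m odd
    rewrite ℕₚ.+-suc m m | odd | ≡.trans (odd-suc s) (≡.cong not odd) =
    +-congˡ (+-identityˡ _)

  ∏-split : ∀ t s i m → ∏ t s (i ℕ.+ m) ≈ ∏ t s i * ∏ t (i ℕ.* t ℕ.+ s) m
  ∏-split t s zero    m = sym (*-identityˡ _)
  ∏-split t s (suc i) m = begin
    ∏ t (t ℕ.+ s) (i ℕ.+ m) + p s * ∏ t (t ℕ.+ s) (i ℕ.+ m)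
      ≈⟨ +-cong split (*-congˡ split) ⟩
    x * y + p s * (x * y)
      ≈⟨ solve 3 (λ x y z → x :* y :+ z :* (x :* y) := (x :+ z :* x) :* y) refl x y (p s) ⟩
    (x + p s * x) * y ∎
    where
    x = ∏ t (t ℕ.+ s) i
    y = ∏ t (t ℕ.+ i ℕ.* t ℕ.+ s) m
    index : i ℕ.* t ℕ.+ (t ℕ.+ s) ≡ t ℕ.+ i ℕ.* t ℕ.+ s
    index = index-lemma (i ℕ.* t) t s
      where
      index-lemma : ∀ a t s → a ℕ.+ (t ℕ.+ s) ≡ t ℕ.+ a ℕ.+ s
      index-lemma = solve-∀
    split : ∏ t (t ℕ.+ s) (i ℕ.+ m) ≈ x * y
    split = trans (∏-split t (t ℕ.+ s) i m)
      (*-congˡ (reflexive (≡.cong (λ r → ∏ t r m) index)))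

  mutual
    -- The factors are sorted by the parity of their distance from s. Peeling off one factor
    -- exchanges the two progressions, whence the mutual induction with odd lengths.
    ∏-interleave : ∀ s m → ∏ 1 s (m ℕ.+ m) ≈ ∏ 2 s m * ∏ 2 (suc s) m
    ∏-interleave s zero    = sym (*-identityˡ _)
    ∏-interleave s (suc m) rewrite ℕₚ.+-suc m m = begin
      ∏ 1 (suc s) (suc (m ℕ.+ m)) + p s * ∏ 1 (suc s) (suc (m ℕ.+ m))
        ≈⟨ +-cong (∏-interleave-suc (suc s) m) (*-congˡ (∏-interleave-suc (suc s) m)) ⟩
      y * x + p s * (y * x)
        ≈⟨ solve 3 (λ x y z → y :* x :+ z :* (y :* x) := (x :+ z :* x) :* y) refl x y (p s) ⟩
      (x + p s * x) * y ∎
      where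
      x = ∏ 2 (2 ℕ.+ s) m
      y = ∏ 2 (suc s) (suc m)

    ∏-interleave-suc : ∀ s m → ∏ 1 s (suc (m ℕ.+ m)) ≈ ∏ 2 s (suc m) * ∏ 2 (suc s) m
    ∏-interleave-suc s m = begin
      ∏ 1 (suc s) (m ℕ.+ m) + p s * ∏ 1 (suc s) (m ℕ.+ m)
        ≈⟨ +-cong (∏-interleave (suc s) m) (*-congˡ (∏-interleave (suc s) m)) ⟩
      y * x + p s * (y * x)
        ≈⟨ solve 3 (λ x y z → y :* x :+ z :* (y :* x) := (x :+ z :* x) :* y) refl x y (p s) ⟩
      (x + p s * x) * y ∎
      where
      x = ∏ 2 (2 ℕ.+ s) m
      y = ∏ 2 (suc s) m

  -- Σ_{i ≤ n ≤ i + m} v n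
  ∑ : (ℕ → Carrier) → ℕ → ℕ → Carrier
  ∑ v i zero    = v i
  ∑ v i (suc m) = v i + ∑ v (suc i) m

  ∑₁ : (ℕ → Carrier) → ℕ → Carrier
  ∑₁ a zero    = 0#
  ∑₁ a (suc m) = ∑₁ a m + a (suc m)

  -- The telescoping recurrence.

  -- Here p i and a i stand for qⁱ and (-1)ⁱ q^{i²} modulo q^{N+1}.
  module Telescoping (a : ℕ → Carrier) (N : ℕ)
    (a₀≈1 : a 0 ≈ 1#)
    (cancel : ∀ s i → a i * p (suc (s ℕ.+ (i ℕ.+ i))) + p s * a (suc i) ≈ 0#)
    (negligible : ∀ s i → N ℕ.< s ℕ.+ i ℕ.* i → p s * a i ≈ 0#) where

    -- The series E k of the header, truncated, is E (2 k + 2) 0 m; its tail from the i-th term on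
    -- is E (2 k + 2 i + 2) i (m - i).
    E : ℕ → ℕ → ℕ → Carrier
    E r i zero    = a i
    E r i (suc m) = a i * ∏ 2 r (suc m) + E (2 ℕ.+ r) (suc i) m

    -- Peeling the factor 1 + p r off the i-th product P leaves `a i * p r * P`, and the added
    -- series starts with `p s * a (suc i) * P`: these cancel by `cancel`, and so on through the
    -- sum. The right-hand series is one term shorter, which leaves over the last `a`. An equation
    -- ties r to s + 2 i + 1, so that r can move by 2 as i moves by 1.
    E-shift : ∀ s i m {r} → r ≡ suc (s ℕ.+ (i ℕ.+ i)) →
      E r i (suc m) + p s * E (2 ℕ.+ r) (suc i) m ≈ E (2 ℕ.+ r) i m + a (suc i ℕ.+ m)
    E-shift s i zero {r} r≡ rewrite ℕₚ.+-identityʳ i = begin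
      x * (1# + y * 1#) + z + w * z
        ≈⟨ solve 5 (λ x y z w e → x :* (e :+ y :* e) :+ z :+ w :* z := x :* e :+ z :+ (x :* y :* e :+ w :* z)) refl x y z w 1# ⟩
      x * 1# + z + (x * y * 1# + w * z)
        ≈⟨ +-cong (+-congʳ (*-identityʳ x)) (+-congʳ (*-identityʳ (x * y))) ⟩
      x + z + (x * y + w * z)
        ≈⟨ +-congˡ xy+wz≈0 ⟩
      x + z + 0#
        ≈⟨ +-identityʳ _ ⟩
      x + z ∎
      where
      x = a i
      y = p r
      z = a (suc i)
      w = p s
      xy+wz≈0 : x * y + w * z ≈ 0#
      xy+wz≈0 = trans (+-congʳ (*-congˡ (reflexive (≡.cong p r≡)))) (cancel s i)
    E-shift s i (suc m) {r} r≡ = begin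
      x * (P + y * P) + E′ + w * (z * P + E″)
        ≈⟨ solve 7 (λ x y z w P E′ E″ → x :* (P :+ y :* P) :+ E′ :+ w :* (z :* P :+ E″)
              := (x :* P :+ (E′ :+ w :* E″)) :+ (x :* y :+ w :* z) :* P) refl x y z w P E′ E″ ⟩
      (x * P + (E′ + w * E″)) + (x * y + w * z) * P
        ≈⟨ +-cong (+-congˡ (E-shift s (suc i) m r′≡)) (trans (*-congʳ xy+wz≈0) (zeroˡ P)) ⟩
      (x * P + (E (4 ℕ.+ r) (suc i) m + a (2 ℕ.+ i ℕ.+ m))) + 0#
        ≈⟨ trans (+-identityʳ _) (sym (+-assoc _ _ _)) ⟩
      (x * P + E (4 ℕ.+ r) (suc i) m) + a (2 ℕ.+ i ℕ.+ m)
        ≈⟨ +-congˡ (reflexive (≡.cong (λ n → a (suc n)) (≡.sym (ℕₚ.+-suc i m)))) ⟩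
      (x * P + E (4 ℕ.+ r) (suc i) m) + a (suc i ℕ.+ suc m) ∎
      where
      x = a i
      y = p r
      z = a (suc i)
      w = p s
      P = ∏ 2 (2 ℕ.+ r) (suc m)
      E′ = E (2 ℕ.+ r) (suc i) (suc m)
      E″ = E (4 ℕ.+ r) (2 ℕ.+ i) m
      xy+wz≈0 : x * y + w * z ≈ 0#
      xy+wz≈0 = trans (+-congʳ (*-congˡ (reflexive (≡.cong p r≡)))) (cancel s i)
      r′≡ : 2 ℕ.+ r ≡ suc (s ℕ.+ (suc i ℕ.+ suc i))
      r′≡ = ≡.trans (≡.cong (2 ℕ.+_) r≡)
        (index-lemma s i)
        where
        index-lemma : ∀ s i → 3 ℕ.+ (s ℕ.+ (i ℕ.+ i)) ≡ suc (s ℕ.+ (suc i ℕ.+ suc i))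
        index-lemma = solve-∀

    -- With s = 2 k + 1 this is the recurrence for E k in the header. `E-shift` at i = 0 absorbs
    -- `p s` times the tail of the series; the first term, where `a 0` is 1, supplies the product.
    -- The summand `a (suc m)` is the price of truncation.
    E-recurrence : ∀ s m →
      E (suc s) 0 (suc m) + p s * E (suc s) 0 (suc m) ≈
      E (3 ℕ.+ s) 0 m + p s * ∏ 2 (suc s) (suc m) + a (suc m)
    E-recurrence s m = begin
      E (suc s) 0 (suc m) + p s * (a 0 * P + F)
        ≈⟨ +-congˡ (trans (*-congˡ (+-congʳ (trans (*-congʳ a₀≈1) (*-identityˡ P)))) (distribˡ _ _ _)) ⟩
      E (suc s) 0 (suc m) + (p s * P + p s * F)
        ≈⟨ solve 3 (λ x y z → x :+ (y :+ z) := (x :+ z) :+ y) refl _ _ _ ⟩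
      E (suc s) 0 (suc m) + p s * F + p s * P
        ≈⟨ +-congʳ (E-shift s 0 m (≡.cong suc (≡.sym (ℕₚ.+-identityʳ s)))) ⟩
      E (3 ℕ.+ s) 0 m + a (suc m) + p s * P
        ≈⟨ solve 3 (λ x y z → (x :+ z) :+ y := (x :+ y) :+ z) refl _ _ _ ⟩
      E (3 ℕ.+ s) 0 m + p s * P + a (suc m) ∎
      where
      P = ∏ 2 (suc s) (suc m)
      F = E (3 ℕ.+ s) 1 m

    -- Every exponent in the product is at least s, so by `negligible` each factor acts on `a i` as
    -- 1.
    ∏*a : ∀ t s m i → N ℕ.< s ℕ.+ i ℕ.* i → ∏ t s m * a i ≈ a i
    ∏*a t s zero    i N< = *-identityˡ _
    ∏*a t s (suc m) i N< = begin
      (P + p s * P) * a i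
        ≈⟨ solve 3 (λ x y z → (x :+ y :* x) :* z := x :* z :+ x :* (y :* z)) refl P (p s) (a i) ⟩
      P * a i + P * (p s * a i)
        ≈⟨ +-cong (∏*a t (t ℕ.+ s) m i (ℕₚ.<-≤-trans N< (ℕₚ.+-monoˡ-≤ (i ℕ.* i) (ℕₚ.m≤n+m s t))))
                  (trans (*-congˡ (negligible s i N<)) (zeroʳ P)) ⟩
      a i + 0#
        ≈⟨ +-identityʳ _ ⟩
      a i ∎
      where P = ∏ t (t ℕ.+ s) m

    -- Each step of the recurrence shortens the truncated series by one term and releases
    -- `a (suc m)`; together with the final `a 0` these remainders build up the theta series, the
    -- limit of L k in the header. The quantity s + 2 m stays constant along the induction, and its
    -- bound makes the released terms immune to the remaining product.
    telescope : ∀ s m → (s % 2 ≡ᵇ 1) ≡ true → N ℕ.≤ s ℕ.+ (m ℕ.+ m) →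
      ∏ 2 s m * E (suc s) 0 m ≈ 1# + oddLeast s (m ℕ.+ m) + ∑₁ a m
    telescope s zero    odd N≤ = begin
      1# * a 0        ≈⟨ trans (*-identityˡ _) a₀≈1 ⟩
      1#              ≈⟨ trans (+-identityʳ _) (+-identityʳ _) ⟨
      1# + 0# + 0#    ∎
    telescope s (suc m) odd N≤ = begin
      (Q + p s * Q) * E₀
        ≈⟨ solve 3 (λ x y z → (x :+ y :* x) :* z := x :* (z :+ y :* z)) refl Q (p s) E₀ ⟩
      Q * (E₀ + p s * E₀)
        ≈⟨ *-congˡ (E-recurrence s m) ⟩
      Q * (E₁ + p s * P + a (suc m))
        ≈⟨ solve 5 (λ Q E y P a → Q :* (E :+ y :* P :+ a) := Q :* E :+ y :* (P :* Q) :+ Q :* a) refl Q E₁ (p s) P (a (suc m)) ⟩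
      Q * E₁ + p s * (P * Q) + Q * a (suc m)
        -- P and Q run over the exponents s + 1, s + 3, ... and s + 2, s + 4, ..., and merge into
        -- one product of step 1.
        ≈⟨ +-cong (+-cong (telescope (2 ℕ.+ s) m odd N≤′) (*-congˡ (sym (∏-interleave-suc (suc s) m))))
                  (∏*a 2 (2 ℕ.+ s) m (suc m) N<) ⟩
      1# + C + ∑₁ a m + p s * ∏ 1 (suc s) (suc (m ℕ.+ m)) + a (suc m)
        ≈⟨ solve 5 (λ e c t x y → e :+ c :+ t :+ x :+ y := e :+ (x :+ c) :+ (t :+ y)) refl 1# C (∑₁ a m) _ (a (suc m)) ⟩
      1# + (p s * ∏ 1 (suc s) (suc (m ℕ.+ m)) + C) + (∑₁ a m + a (suc m))
        ≈⟨ +-congʳ (+-congˡ (oddLeast-step s m odd)) ⟨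
      1# + oddLeast s (suc m ℕ.+ suc m) + ∑₁ a (suc m) ∎
      where
      Q = ∏ 2 (2 ℕ.+ s) m
      P = ∏ 2 (suc s) (suc m)
      E₀ = E (suc s) 0 (suc m)
      E₁ = E (3 ℕ.+ s) 0 m
      C = oddLeast (2 ℕ.+ s) (m ℕ.+ m)
      N≤′ : N ℕ.≤ 2 ℕ.+ s ℕ.+ (m ℕ.+ m)
      N≤′ = ℕₚ.≤-trans N≤ (ℕₚ.≤-reflexive (bound s m))
        where
        bound : ∀ s m → s ℕ.+ (suc m ℕ.+ suc m) ≡ 2 ℕ.+ s ℕ.+ (m ℕ.+ m)
        bound = solve-∀
      N< : N ℕ.< 2 ℕ.+ s ℕ.+ suc m ℕ.* suc m
      N< = ℕ.s≤s (ℕₚ.≤-trans N≤′ (ℕₚ.≤-trans (ℕₚ.m≤m+n _ (m ℕ.* m)) (ℕₚ.≤-reflexive (bound s m))))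
        where
        bound : ∀ s m → 2 ℕ.+ s ℕ.+ (m ℕ.+ m) ℕ.+ m ℕ.* m ≡ 1 ℕ.+ s ℕ.+ suc m ℕ.* suc m
        bound = solve-∀

    -- The hypothesis says that v n is a n / (-q²;q²)_n, without dividing. In the n-th summand the
    -- first n factors of the full product turn `v n` into `a n`; the others, whose exponents start
    -- at 2 n + 2, form the product attached to `a n` in `E`.
    ∏*∑ : (v : ℕ → Carrier) → (∀ n → ∏ 2 2 n * v n ≈ a n) → ∀ i m →
      ∏ 2 2 (i ℕ.+ m) * ∑ v i m ≈ E (i ℕ.* 2 ℕ.+ 2) i m
    ∏*∑ v ∏*v≈a i zero rewrite ℕₚ.+-identityʳ i = ∏*v≈a i
    ∏*∑ v ∏*v≈a i (suc m) = begin
      ∏ 2 2 (i ℕ.+ suc m) * (v i + ∑ v (suc i) m)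
        ≈⟨ distribˡ _ _ _ ⟩
      ∏ 2 2 (i ℕ.+ suc m) * v i + ∏ 2 2 (i ℕ.+ suc m) * ∑ v (suc i) m
        ≈⟨ +-cong (*-congʳ (∏-split 2 2 i (suc m)))
                  (*-congʳ (reflexive (≡.cong (∏ 2 2) (ℕₚ.+-suc i m)))) ⟩
      ∏ 2 2 i * P * v i + ∏ 2 2 (suc i ℕ.+ m) * ∑ v (suc i) m
        ≈⟨ +-cong (solve 3 (λ x y z → x :* y :* z := x :* z :* y) refl _ _ _) (∏*∑ v ∏*v≈a (suc i) m) ⟩
      ∏ 2 2 i * v i * P + E (suc i ℕ.* 2 ℕ.+ 2) (suc i) m
        ≈⟨ +-congʳ (*-congʳ (∏*v≈a i)) ⟩
      a i * P + E (2 ℕ.+ (i ℕ.* 2 ℕ.+ 2)) (suc i) m ∎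
      where P = ∏ 2 (i ℕ.* 2 ℕ.+ 2) (suc m)

    -- Stability of products and sums modulo q^{N+1}.

    ∏≈1 : ∀ t s m → N ℕ.< s → ∏ t s m ≈ 1#
    ∏≈1 t s m N<s = begin
      ∏ t s m        ≈⟨ trans (*-congˡ a₀≈1) (*-identityʳ _) ⟨
      -- `a 0` stands in for 1, so that the instance i = 0 of `∏*a` applies.
      ∏ t s m * a 0  ≈⟨ ∏*a t s m 0 (ℕₚ.m≤n⇒m≤n+o 0 N<s) ⟩
      a 0            ≈⟨ a₀≈1 ⟩
      1#             ∎

    ∏-stable : ∀ t s m j → N ℕ.< m ℕ.* t ℕ.+ s → ∏ t s (m ℕ.+ j) ≈ ∏ t s m
    ∏-stable t s m j N< =
      trans (∏-split t s m j) (trans (*-congˡ (∏≈1 t _ j N<)) (*-identityʳ _))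

    p≈0 : ∀ s → N ℕ.< s → p s ≈ 0#
    p≈0 s N<s = begin
      p s        ≈⟨ trans (*-congˡ a₀≈1) (*-identityʳ _) ⟨
      p s * a 0  ≈⟨ negligible s 0 (ℕₚ.m≤n⇒m≤n+o 0 N<s) ⟩
      0#         ∎

    oddLeast≈0 : ∀ s m → N ℕ.< s → oddLeast s m ≈ 0#
    oddLeast≈0 s zero    N<s = refl
    oddLeast≈0 s (suc m) N<s with s % 2 ≡ᵇ 1
    ... | true  = trans (+-cong (trans (*-congʳ (p≈0 s N<s)) (zeroˡ _))
                                (oddLeast≈0 (suc s) m (ℕₚ.m≤n⇒m≤1+n N<s))) (+-identityʳ _)
    ... | false = trans (+-congˡ (oddLeast≈0 (suc s) m (ℕₚ.m≤n⇒m≤1+n N<s))) (+-identityʳ _)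

    oddLeast-stable : ∀ s m j → N ℕ.< m ℕ.+ s → oddLeast s (m ℕ.+ j) ≈ oddLeast s m
    oddLeast-stable s zero    j N< = oddLeast≈0 s j N<
    oddLeast-stable s (suc m) j N<
      with s % 2 ≡ᵇ 1 | ≡.subst (N ℕ.<_) (≡.sym (ℕₚ.+-suc m s)) N<
    ... | false | N<′ = +-congˡ (oddLeast-stable (suc s) m j N<′)
    ... | true  | N<′ = +-cong
      (*-congˡ (∏-stable 1 (suc s) m j (≡.subst (λ k → N ℕ.< k ℕ.+ suc s) (≡.sym (ℕₚ.*-identityʳ m)) N<′)))
      (oddLeast-stable (suc s) m j N<′)

    -- Modulo q^{N+1} another N factors change nothing, and with 2 N factors the product splits into
    -- exactly N odd and N even exponents. The even half clears the denominators of v; the odd half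
    -- is the prefactor of L 0.
    ∏*∑≈oddLeast : (v : ℕ → Carrier) → (∀ n → ∏ 2 2 n * v n ≈ a n) →
      ∏ 1 1 N * ∑ v 0 N ≈ 1# + oddLeast 1 N + ∑₁ a N
    ∏*∑≈oddLeast v ∏*v≈a = begin
      ∏ 1 1 N * ∑ v 0 N
        ≈⟨ *-congʳ (∏-stable 1 1 N N (≡.subst (λ k → N ℕ.< k ℕ.+ 1) (≡.sym (ℕₚ.*-identityʳ N)) N<N+1)) ⟨
      ∏ 1 1 (N ℕ.+ N) * ∑ v 0 N
        ≈⟨ *-congʳ (∏-interleave 1 N) ⟩
      ∏ 2 1 N * ∏ 2 2 N * ∑ v 0 N
        ≈⟨ trans (*-assoc _ _ _) (*-congˡ (∏*∑ v ∏*v≈a 0 N)) ⟩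
      ∏ 2 1 N * E 2 0 N
        ≈⟨ telescope 1 N ≡.refl (ℕₚ.m≤n⇒m≤1+n (ℕₚ.m≤m+n N N)) ⟩
      1# + oddLeast 1 (N ℕ.+ N) + ∑₁ a N
        ≈⟨ +-congʳ (+-congˡ (oddLeast-stable 1 N N N<N+1)) ⟩
      1# + oddLeast 1 N + ∑₁ a N ∎
      where
      N<N+1 : N ℕ.< N ℕ.+ 1
      N<N+1 = ℕₚ.≤-reflexive (ℕₚ.+-comm 1 N)

-- Convolution of coefficient sequences

open import Data.Integer using (ℤ; 0ℤ; _+_; _*_)

shift : PS → PS
shift f n = f (suc n)

map-upTo-suc : ∀ {A : Set} (h : ℕ → A) n → map h (upTo (suc n)) ≡ h 0 ∷ map (h ∘ suc) (upTo n)
map-upTo-suc h n = cong (h 0 ∷_) (≡.trans (Listₚ.map-applyUpTo suc h n) (≡.sym (Listₚ.map-upTo (h ∘ suc) n)))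

⊛-suc : ∀ f g n → (f ⊛ g) (suc n) ≡ f 0 * g (suc n) + (shift f ⊛ g) n
⊛-suc f g n = cong sumℤ (map-upTo-suc (λ i → f i * g (suc n ∸ i)) (suc n))

-- A convolution coefficient of index n sees only indices up to n; the bounded hypotheses let `⊛`
-- descend to the quotient by q^{N+1}.
⊛-cong : ∀ n {f f′ g g′} → (∀ i → i ≤ n → f i ≡ f′ i) → (∀ i → i ≤ n → g i ≡ g′ i) →
  (f ⊛ g) n ≡ (f′ ⊛ g′) n
⊛-cong zero f≡ g≡ = cong (_+ 0ℤ) (cong₂ _*_ (f≡ 0 z≤n) (g≡ 0 z≤n))
⊛-cong (suc n) {f} {f′} {g} {g′} f≡ g≡ = begin
  (f ⊛ g) (suc n)                       ≡⟨ ⊛-suc f g n ⟩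
  f 0 * g (suc n) + (shift f ⊛ g) n     ≡⟨ cong₂ _+_ (cong₂ _*_ (f≡ 0 z≤n) (g≡ _ ℕₚ.≤-refl))
                                             (⊛-cong n (λ i i≤n → f≡ (suc i) (s≤s i≤n))
                                                       (λ i i≤n → g≡ i (ℕₚ.m≤n⇒m≤1+n i≤n))) ⟩
  f′ 0 * g′ (suc n) + (shift f′ ⊛ g′) n ≡⟨ ⊛-suc f′ g′ n ⟨
  (f′ ⊛ g′) (suc n)                     ∎
  where open ≡-Reasoning

⊛-congˡ : ∀ g n {f f′} → f ≗ f′ → (f ⊛ g) n ≡ (f′ ⊛ g) n
⊛-congˡ g n f≗f′ = ⊛-cong n {g = g} {g} (λ i _ → f≗f′ i) (λ _ _ → ≡.refl)

-- The mirror image of `⊛-suc`; playing the two against each other gives commutativity by induction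
-- on n.
⊛-suc′ : ∀ f g n → (f ⊛ g) (suc n) ≡ (f ⊛ shift g) n + f (suc n) * g 0
⊛-suc′ f g zero = ≡.trans (⊛-suc f g 0) (lemma (f 0 * g 1) (f 1 * g 0))
  where
  lemma : ∀ x y → x + (y + 0ℤ) ≡ (x + 0ℤ) + y
  lemma = solveℤ-∀
⊛-suc′ f g (suc n) = begin
  (f ⊛ g) (2 ℕ.+ n)
    ≡⟨ ⊛-suc f g (suc n) ⟩
  f 0 * g (2 ℕ.+ n) + (shift f ⊛ g) (suc n)
    ≡⟨ cong (f 0 * g (2 ℕ.+ n) +_) (⊛-suc′ (shift f) g n) ⟩
  f 0 * g (2 ℕ.+ n) + ((shift f ⊛ shift g) n + f (2 ℕ.+ n) * g 0)
    ≡⟨ ℤₚ.+-assoc (f 0 * g (2 ℕ.+ n)) _ _ ⟨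
  f 0 * g (2 ℕ.+ n) + (shift f ⊛ shift g) n + f (2 ℕ.+ n) * g 0
    ≡⟨ cong (_+ f (2 ℕ.+ n) * g 0) (⊛-suc f (shift g) n) ⟨
  (f ⊛ shift g) (suc n) + f (2 ℕ.+ n) * g 0 ∎
  where open ≡-Reasoning

⊛-comm : ∀ f g n → (f ⊛ g) n ≡ (g ⊛ f) n
⊛-comm f g zero = cong (_+ 0ℤ) (ℤₚ.*-comm (f 0) (g 0))
⊛-comm f g (suc n) = begin
  (f ⊛ g) (suc n)                    ≡⟨ ⊛-suc f g n ⟩
  f 0 * g (suc n) + (shift f ⊛ g) n  ≡⟨ cong₂ _+_ (ℤₚ.*-comm (f 0) _) (⊛-comm (shift f) g n) ⟩
  g (suc n) * f 0 + (g ⊛ shift f) n  ≡⟨ ℤₚ.+-comm (g (suc n) * f 0) _ ⟩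
  (g ⊛ shift f) n + g (suc n) * f 0  ≡⟨ ⊛-suc′ g f n ⟨
  (g ⊛ f) (suc n)                    ∎
  where open ≡-Reasoning

⊛-distribʳ-⊕ : ∀ h f g n → ((f ⊕ g) ⊛ h) n ≡ (f ⊛ h) n + (g ⊛ h) n
⊛-distribʳ-⊕ h f g zero = lemma (f 0) (g 0) (h 0)
  where
  lemma : ∀ x y z → (x + y) * z + 0ℤ ≡ (x * z + 0ℤ) + (y * z + 0ℤ)
  lemma = solveℤ-∀
⊛-distribʳ-⊕ h f g (suc n) = begin
  ((f ⊕ g) ⊛ h) (suc n)
    ≡⟨ ⊛-suc (f ⊕ g) h n ⟩
  (f 0 + g 0) * h (suc n) + ((shift f ⊕ shift g) ⊛ h) n
    ≡⟨ cong ((f 0 + g 0) * h (suc n) +_) (⊛-distribʳ-⊕ h (shift f) (shift g) n) ⟩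
  (f 0 + g 0) * h (suc n) + ((shift f ⊛ h) n + (shift g ⊛ h) n)
    ≡⟨ lemma (f 0) (g 0) (h (suc n)) _ _ ⟩
  (f 0 * h (suc n) + (shift f ⊛ h) n) + (g 0 * h (suc n) + (shift g ⊛ h) n)
    ≡⟨ cong₂ _+_ (⊛-suc f h n) (⊛-suc g h n) ⟨
  (f ⊛ h) (suc n) + (g ⊛ h) (suc n) ∎
  where
  open ≡-Reasoning
  lemma : ∀ x y z u v → (x + y) * z + (u + v) ≡ (x * z + u) + (y * z + v)
  lemma = solveℤ-∀

scale-⊛ : ∀ c f g n → ((λ i → c * f i) ⊛ g) n ≡ c * (f ⊛ g) n
scale-⊛ c f g zero = lemma c (f 0) (g 0)
  where
  lemma : ∀ x y z → x * y * z + 0ℤ ≡ x * (y * z + 0ℤ)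
  lemma = solveℤ-∀
scale-⊛ c f g (suc n) = begin
  ((λ i → c * f i) ⊛ g) (suc n)
    ≡⟨ ⊛-suc (λ i → c * f i) g n ⟩
  c * f 0 * g (suc n) + ((λ i → c * shift f i) ⊛ g) n
    ≡⟨ cong (c * f 0 * g (suc n) +_) (scale-⊛ c (shift f) g n) ⟩
  c * f 0 * g (suc n) + c * (shift f ⊛ g) n
    ≡⟨ lemma c (f 0) (g (suc n)) _ ⟩
  c * (f 0 * g (suc n) + (shift f ⊛ g) n)
    ≡⟨ cong (c *_) (⊛-suc f g n) ⟨
  c * (f ⊛ g) (suc n) ∎
  where
  open ≡-Reasoning
  lemma : ∀ x y z u → x * y * z + x * u ≡ x * (y * z + u)
  lemma = solveℤ-∀

⊛-assoc : ∀ f g h n → ((f ⊛ g) ⊛ h) n ≡ (f ⊛ (g ⊛ h)) n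
⊛-assoc f g h zero = lemma (f 0) (g 0) (h 0)
  where
  lemma : ∀ x y z → (x * y + 0ℤ) * z + 0ℤ ≡ x * (y * z + 0ℤ) + 0ℤ
  lemma = solveℤ-∀
⊛-assoc f g h (suc n) = begin
  ((f ⊛ g) ⊛ h) (suc n)
    ≡⟨ ⊛-suc (f ⊛ g) h n ⟩
  (f 0 * g 0 + 0ℤ) * h (suc n) + (shift (f ⊛ g) ⊛ h) n
    -- The shift of f ⊛ g is f 0 times the shift of g plus `shift f ⊛ g`, a twisted Leibniz rule
    -- that reduces the claim to index n.
    ≡⟨ cong ((f 0 * g 0 + 0ℤ) * h (suc n) +_) (⊛-congˡ h n (⊛-suc f g)) ⟩
  (f 0 * g 0 + 0ℤ) * h (suc n) + (((λ i → f 0 * shift g i) ⊕ (shift f ⊛ g)) ⊛ h) n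
    ≡⟨ cong ((f 0 * g 0 + 0ℤ) * h (suc n) +_) (⊛-distribʳ-⊕ h (λ i → f 0 * shift g i) (shift f ⊛ g) n) ⟩
  (f 0 * g 0 + 0ℤ) * h (suc n) + (((λ i → f 0 * shift g i) ⊛ h) n + ((shift f ⊛ g) ⊛ h) n)
    ≡⟨ cong ((f 0 * g 0 + 0ℤ) * h (suc n) +_) (cong₂ _+_ (scale-⊛ (f 0) (shift g) h n) (⊛-assoc (shift f) g h n)) ⟩
  (f 0 * g 0 + 0ℤ) * h (suc n) + (f 0 * (shift g ⊛ h) n + (shift f ⊛ (g ⊛ h)) n)
    ≡⟨ lemma (f 0) (g 0) (h (suc n)) _ _ ⟩
  f 0 * (g 0 * h (suc n) + (shift g ⊛ h) n) + (shift f ⊛ (g ⊛ h)) n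
    ≡⟨ cong (λ x → f 0 * x + (shift f ⊛ (g ⊛ h)) n) (⊛-suc g h n) ⟨
  f 0 * (g ⊛ h) (suc n) + (shift f ⊛ (g ⊛ h)) n
    ≡⟨ ⊛-suc f (g ⊛ h) n ⟨
  (f ⊛ (g ⊛ h)) (suc n) ∎
  where
  open ≡-Reasoning
  lemma : ∀ x y z u v → (x * y + 0ℤ) * z + (x * u + v) ≡ x * (y * z + u) + v
  lemma = solveℤ-∀

0⊛ : ∀ {f} g n → (∀ i → f i ≡ 0ℤ) → (f ⊛ g) n ≡ 0ℤ
0⊛ {f} g n f≡0 = ≡.trans (⊛-congˡ g n f≡0) (scale-⊛ 0ℤ (λ _ → 0ℤ) g n)

const-⊛ : ∀ c f g n → f 0 ≡ c → (∀ i → f (suc i) ≡ 0ℤ) → (f ⊛ g) n ≡ c * g n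
const-⊛ c f g zero f₀≡ f≡0 = ≡.trans (ℤₚ.+-identityʳ _) (cong (_* g 0) f₀≡)
const-⊛ c f g (suc n) f₀≡ f≡0 =
  ≡.trans (⊛-suc f g n) (≡.trans (cong₂ _+_ (cong (_* g (suc n)) f₀≡) (0⊛ g n f≡0)) (ℤₚ.+-identityʳ _))

-- Monomials and their products.

mono-diag : ∀ c k → mono c k k ≡ c
mono-diag c zero    = ≡.refl
mono-diag c (suc k) = mono-diag c k

mono-off : ∀ c {k n} → n ≢ k → mono c k n ≡ 0ℤ
mono-off c {zero}  {zero}  n≢k = contradiction ≡.refl n≢k
mono-off c {zero}  {suc n} n≢k = ≡.refl
mono-off c {suc k} {zero}  n≢k = ≡.refl
mono-off c {suc k} {suc n} n≢k = mono-off c {k} {n} (n≢k ∘ cong suc)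

mono-0 : ∀ k n → mono 0ℤ k n ≡ 0ℤ
mono-0 k n with n ≡ᵇ k
... | true  = ≡.refl
... | false = ≡.refl

scale-mono : ∀ c d k n → c * mono d k n ≡ mono (c * d) k n
scale-mono c d k n with n ≡ᵇ k
... | true  = ≡.refl
... | false = ℤₚ.*-zeroʳ c

mono-+ : ∀ c d k n → mono c k n + mono d k n ≡ mono (c + d) k n
mono-+ c d k n with n ≡ᵇ k
... | true  = ≡.refl
... | false = ≡.refl

mono-⊛-< : ∀ c k g {n} → n < k → (mono c k ⊛ g) n ≡ 0ℤ
mono-⊛-< c (suc k) g {zero}  _         = ≡.refl
mono-⊛-< c (suc k) g {suc n} (s≤s n<k) =
  ≡.trans (⊛-suc (mono c (suc k)) g n) (≡.trans (ℤₚ.+-identityˡ _) (mono-⊛-< c k g n<k))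

mono-⊛-mono : ∀ c k d l n → (mono c k ⊛ mono d l) n ≡ mono (c * d) (k ℕ.+ l) n
mono-⊛-mono c zero    d l n       = ≡.trans (const-⊛ c (mono c 0) (mono d l) n ≡.refl (λ _ → ≡.refl)) (scale-mono c d l n)
mono-⊛-mono c (suc k) d l zero    = ≡.refl
mono-⊛-mono c (suc k) d l (suc n) =
  ≡.trans (⊛-suc (mono c (suc k)) (mono d l) n) (≡.trans (ℤₚ.+-identityˡ _) (mono-⊛-mono c k d l n))

-- The substitution q ↦ -q.

negVar-⊛ : ∀ f g n → negVar (f ⊛ g) n ≡ (negVar f ⊛ negVar g) n
negVar-⊛ f g zero = lemma (f 0) (g 0)
  where
  lemma : ∀ x y → 1ℤ * (x * y + 0ℤ) ≡ (1ℤ * x) * (1ℤ * y) + 0ℤ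
  lemma = solveℤ-∀
negVar-⊛ f g (suc n) = begin
  - sgn n * (f ⊛ g) (suc n)
    ≡⟨ cong (- sgn n *_) (⊛-suc f g n) ⟩
  - sgn n * (f 0 * g (suc n) + (shift f ⊛ g) n)
    -- Shifting commutes with q ↦ -q only up to sign; the factor `- 1ℤ` is set aside here and
    -- absorbed when the shift moves back outside.
    ≡⟨ lemma (sgn n) (f 0) (g (suc n)) _ ⟩
  1ℤ * f 0 * (- sgn n * g (suc n)) + - 1ℤ * negVar (shift f ⊛ g) n
    ≡⟨ cong (λ x → 1ℤ * f 0 * (- sgn n * g (suc n)) + - 1ℤ * x) (negVar-⊛ (shift f) g n) ⟩
  1ℤ * f 0 * (- sgn n * g (suc n)) + - 1ℤ * (negVar (shift f) ⊛ negVar g) n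
    ≡⟨ cong (1ℤ * f 0 * (- sgn n * g (suc n)) +_) (scale-⊛ (- 1ℤ) (negVar (shift f)) (negVar g) n) ⟨
  1ℤ * f 0 * (- sgn n * g (suc n)) + ((λ i → - 1ℤ * negVar (shift f) i) ⊛ negVar g) n
    ≡⟨ cong (1ℤ * f 0 * (- sgn n * g (suc n)) +_) (⊛-congˡ (negVar g) n (λ i → lemma′ (sgn i) (f (suc i)))) ⟩
  1ℤ * f 0 * (- sgn n * g (suc n)) + (shift (negVar f) ⊛ negVar g) n
    ≡⟨ ⊛-suc (negVar f) (negVar g) n ⟨
  (negVar f ⊛ negVar g) (suc n) ∎
  where
  open ≡-Reasoning
  lemma : ∀ s x y z → - s * (x * y + z) ≡ 1ℤ * x * (- s * y) + - 1ℤ * (s * z)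
  lemma = solveℤ-∀
  lemma′ : ∀ s x → - 1ℤ * (s * x) ≡ - s * x
  lemma′ = solveℤ-∀

negVar-mono : ∀ c k n → negVar (mono c k) n ≡ mono (sgn k * c) k n
negVar-mono c k n with n ℕ.≟ k
... | yes ≡.refl = ≡.trans (cong (sgn n *_) (mono-diag c n)) (≡.sym (mono-diag (sgn n * c) n))
... | no n≢k   = ≡.trans (cong (sgn n *_) (mono-off c n≢k))
                   (≡.trans (ℤₚ.*-zeroʳ (sgn n)) (≡.sym (mono-off (sgn k * c) n≢k)))

-- The difference (n + 1)² - n² = 2 n + 1 is odd. This turns the sign of q^{n²} under q ↦ -q into
-- the sign (-1)ⁿ of the theta series.
sgn-square : ∀ n → sgn (n ℕ.* n) ≡ sgn n
sgn-square zero    = ≡.refl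
sgn-square (suc n) = cong -_ (begin
  sgn (n ℕ.+ n ℕ.* suc n)    ≡⟨ cong (λ k → sgn (n ℕ.+ k)) (ℕₚ.*-suc n n) ⟩
  sgn (n ℕ.+ (n ℕ.+ n ℕ.* n)) ≡⟨ sgn-double n (n ℕ.* n) ⟩
  sgn (n ℕ.* n)              ≡⟨ sgn-square n ⟩
  sgn n                      ∎)
  where
  open ≡-Reasoning
  sgn-double : ∀ n k → sgn (n ℕ.+ (n ℕ.+ k)) ≡ sgn k
  sgn-double zero    k = ≡.refl
  sgn-double (suc n) k rewrite ℕₚ.+-suc n (n ℕ.+ k) =
    ≡.trans (ℤₚ.neg-involutive (sgn (n ℕ.+ (n ℕ.+ k)))) (sgn-double n k)

-- Reciprocals of power series.

zipWith-map-map : ∀ (f g : ℕ → ℤ) xs → zipWith _*_ (map f xs) (map g xs) ≡ map (λ i → f i * g i) xs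
zipWith-map-map f g []       = ≡.refl
zipWith-map-map f g (x ∷ xs) = cong (f x * g x ∷_) (zipWith-map-map f g xs)

-- Descending order is the order in which a convolution reads its second factor, so the recursion
-- for the inverse becomes a convolution.
invRev≡ : ∀ a n → invRev a n ≡ map (λ i → inv a (n ∸ i)) (upTo (suc n))
invRev≡ a zero    = ≡.refl
invRev≡ a (suc n) = ≡.trans (cong (inv a (suc n) ∷_) (invRev≡ a n)) (≡.sym (map-upTo-suc (λ i → inv a (suc n ∸ i)) (suc n)))

inv-suc : ∀ a n → inv a (suc n) ≡ - (shift a ⊛ inv a) n
inv-suc a n = cong (-_ ∘ sumℤ)
  (≡.trans (cong (zipWith _*_ (map (shift a) (upTo (suc n)))) (invRev≡ a n)) (zipWith-map-map (shift a) (λ i → inv a (n ∸ i)) (upTo (suc n))))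

⊛-inv : ∀ a → a 0 ≡ 1ℤ → ∀ n → (a ⊛ inv a) n ≡ const 1ℤ n
⊛-inv a a₀≡1 zero    = cong (λ x → x * 1ℤ + 0ℤ) a₀≡1
⊛-inv a a₀≡1 (suc n) = begin
  (a ⊛ inv a) (suc n)        ≡⟨ ⊛-suc a (inv a) n ⟩
  a 0 * inv a (suc n) + S    ≡⟨ cong₂ (λ x y → x * y + S) a₀≡1 (inv-suc a n) ⟩
  1ℤ * - S + S               ≡⟨ cong (_+ S) (ℤₚ.*-identityˡ (- S)) ⟩
  - S + S                    ≡⟨ ℤₚ.+-inverseˡ S ⟩
  0ℤ                         ∎
  where
  open ≡-Reasoning
  S = (shift a ⊛ inv a) n

-- Truncated power series as a commutative semiring.

const-0 : ∀ n → const 0ℤ n ≡ 0ℤ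
const-0 zero    = ≡.refl
const-0 (suc n) = ≡.refl

infix 4 _≈[_]_

record _≈[_]_ (f : PS) (N : ℕ) (g : PS) : Set where
  constructor agree
  field coeff : ∀ n → n ≤ N → f n ≡ g n

open _≈[_]_

≗⇒≈ : ∀ {f g N} → f ≗ g → f ≈[ N ] g
≗⇒≈ f≗g = agree (λ n _ → f≗g n)

-- ℤ[[q]] / (q^{N+1})
truncated : ℕ → CommutativeSemiring 0ℓ 0ℓ
truncated N = record
  { Carrier = PS ; _≈_ = _≈[ N ]_ ; _+_ = _⊕_ ; _*_ = _⊛_ ; 0# = const 0ℤ ; 1# = const 1ℤ
  ; isCommutativeSemiring = isCommutativeSemiringˡ record
    { +-isCommutativeMonoid = record
      { isMonoid = record
        { isSemigroup = record
          { isMagma = record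
            { isEquivalence = isEquivalence
            ; ∙-cong = λ f≈ g≈ → agree λ n n≤N → cong₂ _+_ (coeff f≈ n n≤N) (coeff g≈ n n≤N) }
          ; assoc = λ f g h → ≗⇒≈ λ n → ℤₚ.+-assoc (f n) (g n) (h n) }
        ; identity = (λ f → ≗⇒≈ λ n → ≡.trans (cong (_+ f n) (const-0 n)) (ℤₚ.+-identityˡ (f n)))
                   , (λ f → ≗⇒≈ λ n → ≡.trans (cong (f n +_) (const-0 n)) (ℤₚ.+-identityʳ (f n))) }
      ; comm = λ f g → ≗⇒≈ λ n → ℤₚ.+-comm (f n) (g n) }
    ; *-isCommutativeMonoid = record
      { isMonoid = record
        { isSemigroup = record
          { isMagma = record
            { isEquivalence = isEquivalence
            ; ∙-cong = λ {f} {f′} {g} {g′} f≈ g≈ → agree λ n n≤N →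
                ⊛-cong n {f} {f′} {g} {g′} (λ i i≤n → coeff f≈ i (ℕₚ.≤-trans i≤n n≤N))
                                           (λ i i≤n → coeff g≈ i (ℕₚ.≤-trans i≤n n≤N)) }
          ; assoc = λ f g h → ≗⇒≈ (⊛-assoc f g h) }
        ; identity = (λ f → ≗⇒≈ (1⊛ f)) , (λ f → ≗⇒≈ λ n → ≡.trans (⊛-comm f (const 1ℤ) n) (1⊛ f n)) }
      ; comm = λ f g → ≗⇒≈ (⊛-comm f g) }
    ; distribʳ = λ h f g → ≗⇒≈ (⊛-distribʳ-⊕ h f g)
    ; zeroˡ = λ f → ≗⇒≈ λ n → ≡.trans (0⊛ f n const-0) (≡.sym (const-0 n)) } }
  where
  isEquivalence : IsEquivalence _≈[ N ]_
  isEquivalence = record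
    { refl  = agree λ _ _ → ≡.refl
    ; sym   = λ f≈g → agree λ n n≤N → ≡.sym (coeff f≈g n n≤N)
    ; trans = λ f≈g g≈h → agree λ n n≤N → ≡.trans (coeff f≈g n n≤N) (coeff g≈h n n≤N) }
  1⊛ : ∀ f n → (const 1ℤ ⊛ f) n ≡ f n
  1⊛ f n = ≡.trans (const-⊛ 1ℤ (const 1ℤ) f n ≡.refl (λ _ → ≡.refl)) (ℤₚ.*-identityˡ (f n))

-- Theta terms and Pochhammer symbols.

mono-0≗const : ∀ c → mono c 0 ≗ const c
mono-0≗const c zero    = ≡.refl
mono-0≗const c (suc n) = ≡.refl

X : ℕ → PS
X = mono 1ℤ

θ : ℕ → PS
θ n = mono (sgn n) (n ℕ.* n)

-- The remaining exponents are re-indexed to start at t + s, to match the recursion of `∏`.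
poch-suc : ∀ c s t n → poch c s t (suc n) ≡ (const 1ℤ ⊕ mono (- c) s) ⊛ poch c (t ℕ.+ s) t n
poch-suc c s t n = cong prodPS (≡.trans (map-upTo-suc (factor s) n) (cong₂ _∷_
    (cong (λ k → const 1ℤ ⊕ mono (- c) k) (≡.trans (cong (s ℕ.+_) (ℕₚ.*-zeroʳ t)) (ℕₚ.+-identityʳ s)))
    (Listₚ.map-cong (λ j → cong (λ k → const 1ℤ ⊕ mono (- c) k) (index j)) (upTo n))))
  where
  factor : ℕ → ℕ → PS
  factor s j = const 1ℤ ⊕ mono (- c) (s ℕ.+ t ℕ.* j)
  index-lemma : ∀ s t a → s ℕ.+ (t ℕ.+ a) ≡ t ℕ.+ s ℕ.+ a
  index-lemma = solve-∀
  index : ∀ j → s ℕ.+ t ℕ.* suc j ≡ t ℕ.+ s ℕ.+ t ℕ.* j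
  index j = ≡.trans (cong (s ℕ.+_) (ℕₚ.*-suc t j)) (index-lemma s t (t ℕ.* j))

-- Generating functions of partitions into distinct parts.

interval : ℕ → ℕ → List ℕ
interval s zero    = []
interval s (suc m) = s ∷ interval (suc s) m

-- Replaces `upTo` by a list that is recursive in its first element, so that induction can follow
-- `sublists` and `oddLeast` together.
map-upTo≡interval : ∀ {f s} m → (∀ j → f j ≡ j ℕ.+ s) → map f (upTo m) ≡ interval s m
map-upTo≡interval             zero    f≡ = ≡.refl
map-upTo≡interval {f} {s} (suc m) f≡ = ≡.trans (map-upTo-suc f m)
  (cong₂ _∷_ (f≡ 0) (map-upTo≡interval m (λ j → ≡.trans (f≡ (suc j)) (≡.sym (ℕₚ.+-suc j s)))))

gf : List (List ℕ) → PS
gf = foldr (λ ps f → X (sumℕ ps) ⊕ f) (const 0ℤ)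

≡ᵇ-sym : ∀ m n → (m ≡ᵇ n) ≡ (n ≡ᵇ m)
≡ᵇ-sym zero    zero    = ≡.refl
≡ᵇ-sym zero    (suc n) = ≡.refl
≡ᵇ-sym (suc m) zero    = ≡.refl
≡ᵇ-sym (suc m) (suc n) = ≡ᵇ-sym m n

-- The test in `p-do` combines the sum with the parity of the least part. Here parity remains a
-- filter, while the sum test becomes the extraction of the n-th coefficient.
gf-coeff : ∀ n ls → ℤ.pos (length (filterᵇ (isDistinctOddPartition n) ls)) ≡ gf (filterᵇ smallestOdd ls) n
gf-coeff zero    [] = ≡.refl
gf-coeff (suc n) [] = ≡.refl
gf-coeff n (ps ∷ ls) with smallestOdd ps | sumℕ ps ≡ᵇ n in eq
... | false | true  = gf-coeff n ls
... | false | false = gf-coeff n ls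
... | true  | false rewrite ≡ᵇ-sym n (sumℕ ps) | eq =
  ≡.trans (gf-coeff n ls) (≡.sym (ℤₚ.+-identityˡ _))
... | true  | true rewrite ≡ᵇ-sym n (sumℕ ps) | eq = cong (1ℤ +_) (gf-coeff n ls)

filter-smallestOdd-map-∷ : ∀ x ls → filterᵇ smallestOdd (map (x ∷_) ls) ≡
  (if x % 2 ≡ᵇ 1 then map (x ∷_) ls else [])
filter-smallestOdd-map-∷ x [] with x % 2 ≡ᵇ 1
... | true  = ≡.refl
... | false = ≡.refl
filter-smallestOdd-map-∷ x (l ∷ ls) with x % 2 ≡ᵇ 1 | filter-smallestOdd-map-∷ x ls
... | true  | eq = cong ((x ∷ l) ∷_) eq
... | false | eq = eq

-- Finite sums of integers.

*-sumℤ : ∀ c xs → c * sumℤ xs ≡ sumℤ (map (c *_) xs)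
*-sumℤ c []       = ℤₚ.*-zeroʳ c
*-sumℤ c (x ∷ xs) = ≡.trans (ℤₚ.*-distribˡ-+ c x _) (cong (c * x +_) (*-sumℤ c xs))

sumℤ-∷ʳ : ∀ xs y → sumℤ (xs ∷ʳ y) ≡ sumℤ xs + y
sumℤ-∷ʳ []       y = ℤₚ.+-comm y 0ℤ
sumℤ-∷ʳ (x ∷ xs) y = ≡.trans (cong (x +_) (sumℤ-∷ʳ xs y)) (≡.sym (ℤₚ.+-assoc x _ y))

sumℤ-upTo-suc : ∀ (h : ℕ → ℤ) n → sumℤ (map h (upTo (suc n))) ≡ sumℤ (map h (upTo n)) + h n
sumℤ-upTo-suc h n = begin
  sumℤ (map h (upTo (suc n)))    ≡⟨ cong (sumℤ ∘ map h) (Listₚ.upTo-∷ʳ n) ⟨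
  sumℤ (map h (upTo n ∷ʳ n))     ≡⟨ cong sumℤ (Listₚ.map-++ h (upTo n) (n ∷ [])) ⟩
  sumℤ (map h (upTo n) ∷ʳ h n)   ≡⟨ sumℤ-∷ʳ (map h (upTo n)) (h n) ⟩
  sumℤ (map h (upTo n)) + h n    ∎
  where open ≡-Reasoning

sumℤ-stable : ∀ (h : ℕ → ℤ) m j → (∀ k → m ≤ k → h k ≡ 0ℤ) →
  sumℤ (map h (upTo (m ℕ.+ j))) ≡ sumℤ (map h (upTo m))
sumℤ-stable h m zero    h≡0 rewrite ℕₚ.+-identityʳ m = ≡.refl
sumℤ-stable h m (suc j) h≡0 rewrite ℕₚ.+-suc m j = begin
  sumℤ (map h (upTo (suc (m ℕ.+ j))))     ≡⟨ sumℤ-upTo-suc h (m ℕ.+ j) ⟩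
  sumℤ (map h (upTo (m ℕ.+ j))) + h (m ℕ.+ j)
    ≡⟨ cong₂ _+_ (sumℤ-stable h m j h≡0) (h≡0 (m ℕ.+ j) (ℕₚ.m≤m+n m j)) ⟩
  sumℤ (map h (upTo m)) + 0ℤ              ≡⟨ ℤₚ.+-identityʳ _ ⟩
  sumℤ (map h (upTo m))                   ∎
  where open ≡-Reasoning

-- Cancellation of theta terms, and coefficients of the given series.

θ-cancel : ∀ s i n → (θ i ⊛ X (suc (s ℕ.+ (i ℕ.+ i))) ⊕ X s ⊛ θ (suc i)) n ≡ const 0ℤ n
θ-cancel s i n = begin
  (θ i ⊛ X (suc (s ℕ.+ (i ℕ.+ i)))) n + (X s ⊛ θ (suc i)) n
    ≡⟨ cong₂ _+_ (mono-⊛-mono (sgn i) (i ℕ.* i) 1ℤ (suc (s ℕ.+ (i ℕ.+ i))) n)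
                 (mono-⊛-mono 1ℤ s (- sgn i) (suc i ℕ.* suc i) n) ⟩
  mono (sgn i * 1ℤ) (i ℕ.* i ℕ.+ suc (s ℕ.+ (i ℕ.+ i))) n + mono (1ℤ * - sgn i) e n
    -- Both exponents are s + (i + 1)², as i² + 2 i + 1 = (i + 1)², and the signs are opposite.
    ≡⟨ cong₂ _+_ (cong₂ (λ c k → mono c k n) (ℤₚ.*-identityʳ (sgn i)) (index s i))
                 (cong (λ c → mono c e n) (ℤₚ.*-identityˡ (- sgn i))) ⟩
  mono (sgn i) e n + mono (- sgn i) e n
    ≡⟨ mono-+ (sgn i) (- sgn i) e n ⟩
  mono (sgn i + - sgn i) e n
    ≡⟨ cong (λ c → mono c e n) (ℤₚ.+-inverseʳ (sgn i)) ⟩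
  mono 0ℤ e n
    ≡⟨ ≡.trans (mono-0 e n) (≡.sym (const-0 n)) ⟩
  const 0ℤ n ∎
  where
  open ≡-Reasoning
  e = s ℕ.+ suc i ℕ.* suc i
  index : ∀ s i → i ℕ.* i ℕ.+ suc (s ℕ.+ (i ℕ.+ i)) ≡ s ℕ.+ suc i ℕ.* suc i
  index = solve-∀

poch-0 : ∀ c s t n → 0 < s → poch c s t n 0 ≡ 1ℤ
poch-0 c s       t zero    0<s = ≡.refl
poch-0 c (suc s) t (suc n) 0<s = ≡.trans (cong (λ f → f 0) (poch-suc c (suc s) t n))
  (cong (λ x → 1ℤ * x + 0ℤ) (poch-0 c (t ℕ.+ suc s) t n (ℕₚ.m≤n⇒m≤o+n t (s≤s z≤n))))

phiTerm : ℕ → PS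
phiTerm n = X (n ℕ.* n) ⊛ inv (poch (- 1ℤ) 2 2 n)

n≤n² : ∀ n → n ≤ n ℕ.* n
n≤n² zero    = z≤n
n≤n² (suc n) = ℕₚ.m≤m+n (suc n) (n ℕ.* suc n)

-- The n-th coefficient of `phi` sums over k ≤ n; a range independent of n is needed to read it as
-- one sum modulo q^{N+1}. The added terms k > n vanish, as k ≤ k².
negVar-phi : ∀ {n N} → n ≤ N → negVar phi n ≡ sumℤ (map (λ k → negVar (phiTerm k) n) (upTo (suc N)))
negVar-phi {n} {N} n≤N = begin
  sgn n * sumℤ (map (λ k → phiTerm k n) (upTo (suc n)))
    ≡⟨ cong (sgn n *_) (sumℤ-stable (λ k → phiTerm k n) (suc n) (N ∸ n)
         (λ k n<k → mono-⊛-< 1ℤ (k ℕ.* k) (inv (poch (- 1ℤ) 2 2 k)) (ℕₚ.<-≤-trans n<k (n≤n² k)))) ⟨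
  sgn n * sumℤ (map (λ k → phiTerm k n) (upTo (suc n ℕ.+ (N ∸ n))))
    ≡⟨ cong (λ m → sgn n * sumℤ (map (λ k → phiTerm k n) (upTo (suc m)))) (ℕₚ.m+[n∸m]≡n n≤N) ⟩
  sgn n * sumℤ (map (λ k → phiTerm k n) (upTo (suc N)))
    ≡⟨ *-sumℤ (sgn n) (map (λ k → phiTerm k n) (upTo (suc N))) ⟩
  sumℤ (map (sgn n *_) (map (λ k → phiTerm k n) (upTo (suc N))))
    ≡⟨ cong sumℤ (Listₚ.map-∘ {g = sgn n *_} {f = λ k → phiTerm k n} (upTo (suc N))) ⟨
  sumℤ (map (λ k → negVar (phiTerm k) n) (upTo (suc N))) ∎
  where open ≡-Reasoning

pdoSeries≡gf : ∀ n → pdoSeries n ≡ gf (filterᵇ smallestOdd (sublists (interval 1 n))) n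
pdoSeries≡gf zero    = ≡.refl
pdoSeries≡gf (suc n) = ≡.trans
  (gf-coeff (suc n) (sublists (map suc (upTo (suc n)))))
  (cong (λ xs → gf (filterᵇ smallestOdd (sublists xs)) (suc n))
    (map-upTo≡interval (suc n) (λ j → ℕₚ.+-comm 1 j)))

-- Evaluation of both sides modulo q^{N+1}

module Mod (N : ℕ) where

  open CommutativeSemiring (truncated N) using
    ( refl; sym; trans; reflexive; setoid; +-cong; +-congˡ; +-congʳ; +-assoc; +-comm; +-identityˡ; +-identityʳ
    ; *-cong; *-congˡ; *-congʳ; *-identityˡ; *-identityʳ; zeroʳ; distribˡ; distribʳ )
  open Products (truncated N) X
  open import Relation.Binary.Reasoning.Setoid setoid
  open import Algebra.Solver.Ring.NaturalCoefficients.Default (truncated N)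

  mono≈0 : ∀ c k → N < k → mono c k ≈[ N ] const 0ℤ
  mono≈0 c k N<k = agree λ n n≤N →
    ≡.trans (mono-off c (ℕₚ.<⇒≢ (ℕₚ.≤-<-trans n≤N N<k))) (≡.sym (const-0 n))

  θ₀≈1 : θ 0 ≈[ N ] const 1ℤ
  θ₀≈1 = ≗⇒≈ (mono-0≗const 1ℤ)

  θ-negligible : ∀ s i → N < s ℕ.+ i ℕ.* i → X s ⊛ θ i ≈[ N ] const 0ℤ
  θ-negligible s i N< = trans (≗⇒≈ (mono-⊛-mono 1ℤ s (sgn i) (i ℕ.* i))) (mono≈0 _ (s ℕ.+ i ℕ.* i) N<)

  open Telescoping θ N θ₀≈1 (λ s i → ≗⇒≈ (θ-cancel s i)) θ-negligible

  poch≈∏ : ∀ s t m → poch (- 1ℤ) s t m ≈[ N ] ∏ t s m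
  poch≈∏ s t zero    = refl
  poch≈∏ s t (suc m) = begin
    poch (- 1ℤ) s t (suc m)                  ≈⟨ reflexive (poch-suc (- 1ℤ) s t m) ⟩
    (const 1ℤ ⊕ X s) ⊛ poch (- 1ℤ) (t ℕ.+ s) t m ≈⟨ *-congˡ {const 1ℤ ⊕ X s} (poch≈∏ (t ℕ.+ s) t m) ⟩
    (const 1ℤ ⊕ X s) ⊛ ∏ t (t ℕ.+ s) m       ≈⟨ distribʳ (∏ t (t ℕ.+ s) m) (const 1ℤ) (X s) ⟩
    const 1ℤ ⊛ ∏ t (t ℕ.+ s) m ⊕ X s ⊛ ∏ t (t ℕ.+ s) m ≈⟨ +-congʳ {X s ⊛ ∏ t (t ℕ.+ s) m} (*-identityˡ (∏ t (t ℕ.+ s) m)) ⟩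
    ∏ t (t ℕ.+ s) m ⊕ X s ⊛ ∏ t (t ℕ.+ s) m  ∎

  poch-stable : ∀ j → poch (- 1ℤ) 1 1 (N ℕ.+ j) ≈[ N ] poch (- 1ℤ) 1 1 N
  poch-stable j = begin
    poch (- 1ℤ) 1 1 (N ℕ.+ j)  ≈⟨ poch≈∏ 1 1 (N ℕ.+ j) ⟩
    ∏ 1 1 (N ℕ.+ j)            ≈⟨ ∏-stable 1 1 N j (ℕₚ.≤-reflexive (≡.trans (ℕₚ.+-comm 1 N) (cong (ℕ._+ 1) (≡.sym (ℕₚ.*-identityʳ N))))) ⟩
    ∏ 1 1 N                    ≈⟨ poch≈∏ 1 1 N ⟨
    poch (- 1ℤ) 1 1 N          ∎

  negVar-cong : ∀ {f g} → f ≈[ N ] g → negVar f ≈[ N ] negVar g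
  negVar-cong f≈g = agree λ n n≤N → cong (sgn n *_) (coeff f≈g n n≤N)

  negVar-1 : negVar (const 1ℤ) ≈[ N ] const 1ℤ
  negVar-1 = ≗⇒≈ λ { zero → ≡.refl ; (suc n) → ℤₚ.*-zeroʳ (sgn (suc n)) }

  -- The exponents s, s + 2, ... are all even, so q ↦ -q fixes every factor.
  negVar-∏ : ∀ s m → sgn s ≡ 1ℤ → negVar (∏ 2 s m) ≈[ N ] ∏ 2 s m
  negVar-∏ s zero    even = negVar-1
  negVar-∏ s (suc m) even = begin
    negVar (P ⊕ X s ⊛ P)
      ≈⟨ ≗⇒≈ (λ n → ≡.trans (ℤₚ.*-distribˡ-+ (sgn n) (P n) _) (cong (sgn n * P n +_) (negVar-⊛ (X s) P n))) ⟩
    negVar P ⊕ negVar (X s) ⊛ negVar P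
      ≈⟨ +-cong IH (*-cong (≗⇒≈ (λ n → ≡.trans (negVar-mono 1ℤ s n) (cong (λ c → mono (c * 1ℤ) s n) even))) IH) ⟩
    P ⊕ X s ⊛ P ∎
    where
    P = ∏ 2 (2 ℕ.+ s) m
    IH : negVar P ≈[ N ] P
    IH = negVar-∏ (2 ℕ.+ s) m (≡.trans (ℤₚ.neg-involutive (sgn s)) even)

  ∏*phiTerm : ∀ n → ∏ 2 2 n ⊛ negVar (phiTerm n) ≈[ N ] θ n
  ∏*phiTerm n = begin
    ∏ 2 2 n ⊛ negVar (phiTerm n)
      -- The even product is replaced by its own image under q ↦ -q; there it meets the image of
      -- `inv P`, and multiplicativity lets the two cancel.
      ≈⟨ *-cong (sym (negVar-∏ 2 n ≡.refl)) (≗⇒≈ (negVar-⊛ (X (n ℕ.* n)) (inv P))) ⟩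
    negVar (∏ 2 2 n) ⊛ (negVar (X (n ℕ.* n)) ⊛ negVar (inv P))
      ≈⟨ *-congʳ (negVar-cong (sym (poch≈∏ 2 2 n))) ⟩
    negVar P ⊛ (negVar (X (n ℕ.* n)) ⊛ negVar (inv P))
      ≈⟨ solve 3 (λ x y z → x :* (y :* z) := y :* (x :* z)) refl (negVar P) (negVar (X (n ℕ.* n))) (negVar (inv P)) ⟩
    negVar (X (n ℕ.* n)) ⊛ (negVar P ⊛ negVar (inv P))
      ≈⟨ *-congˡ {negVar (X (n ℕ.* n))} (trans (sym (≗⇒≈ (negVar-⊛ P (inv P)))) (trans (negVar-cong (≗⇒≈ (⊛-inv P (poch-0 (- 1ℤ) 2 2 n (s≤s z≤n))))) negVar-1)) ⟩
    negVar (X (n ℕ.* n)) ⊛ const 1ℤ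
      ≈⟨ *-identityʳ _ ⟩
    negVar (X (n ℕ.* n))
      ≈⟨ ≗⇒≈ (λ i → ≡.trans (negVar-mono 1ℤ (n ℕ.* n) i)
           (cong (λ c → mono c (n ℕ.* n) i) (≡.trans (ℤₚ.*-identityʳ _) (sgn-square n)))) ⟩
    θ n ∎
    where P = poch (- 1ℤ) 2 2 n

  ∑-coeff : ∀ v i m n → ∑ v i m n ≡ sumℤ (map (λ k → v (i ℕ.+ k) n) (upTo (suc m)))
  ∑-coeff v i zero    n = ≡.trans (cong (λ k → v k n) (≡.sym (ℕₚ.+-identityʳ i))) (≡.sym (ℤₚ.+-identityʳ _))
  ∑-coeff v i (suc m) n = ≡.trans
    (cong₂ _+_ (cong (λ k → v k n) (≡.sym (ℕₚ.+-identityʳ i)))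
      (≡.trans (∑-coeff v (suc i) m n)
        (cong sumℤ (Listₚ.map-cong (λ k → cong (λ k → v k n) (≡.sym (ℕₚ.+-suc i k))) (upTo (suc m))))))
    (≡.sym (cong sumℤ (map-upTo-suc (λ k → v (i ℕ.+ k) n) (suc m))))

  ∑₁-coeff : ∀ a m n → ∑₁ a m n ≡ sumℤ (map (λ k → a (suc k) n) (upTo m))
  ∑₁-coeff a zero    n = const-0 n
  ∑₁-coeff a (suc m) n = ≡.trans (cong (_+ a (suc m) n) (∑₁-coeff a m n)) (≡.sym (sumℤ-upTo-suc (λ k → a (suc k) n) m))

  negVar-phi≈∑ : negVar phi ≈[ N ] ∑ (negVar ∘ phiTerm) 0 N
  negVar-phi≈∑ = agree λ n n≤N → ≡.trans (negVar-phi n≤N) (≡.sym (∑-coeff (negVar ∘ phiTerm) 0 N n))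

  gf-++ : ∀ ls ls′ → gf (ls ++ ls′) ≈[ N ] gf ls ⊕ gf ls′
  gf-++ []       ls′ = sym (+-identityˡ _)
  gf-++ (l ∷ ls) ls′ = trans (+-congˡ {X (sumℕ l)} (gf-++ ls ls′)) (sym (+-assoc (X (sumℕ l)) (gf ls) (gf ls′)))

  gf-map-∷ : ∀ x ls → gf (map (x ∷_) ls) ≈[ N ] X x ⊛ gf ls
  gf-map-∷ x []       = sym (zeroʳ (X x))
  gf-map-∷ x (l ∷ ls) = trans
    (+-cong (sym (≗⇒≈ (mono-⊛-mono 1ℤ x 1ℤ (sumℕ l)))) (gf-map-∷ x ls)) (sym (distribˡ (X x) (X (sumℕ l)) (gf ls)))

  -- Taking or omitting s is the factor 1 + q^s.
  gf-sublists : ∀ s m → gf (sublists (interval s m)) ≈[ N ] ∏ 1 s m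
  gf-sublists s zero    = trans (+-identityʳ _) θ₀≈1
  gf-sublists s (suc m) = begin
    gf (map (s ∷_) L ++ L)  ≈⟨ gf-++ (map (s ∷_) L) L ⟩
    gf (map (s ∷_) L) ⊕ gf L ≈⟨ +-congʳ {gf L} (gf-map-∷ s L) ⟩
    X s ⊛ gf L ⊕ gf L       ≈⟨ +-comm (X s ⊛ gf L) (gf L) ⟩
    gf L ⊕ X s ⊛ gf L       ≈⟨ +-cong IH (*-congˡ {X s} IH) ⟩
    ∏ 1 s (suc m)           ∎
    where
    L = sublists (interval (suc s) m)
    IH = gf-sublists (suc s) m

  -- A subset containing s has s as its least element, so the first half of `sublists` passes or
  -- fails the parity test as a whole; the subsets without s are left to the induction.
  gf-smallestOdd : ∀ s m → gf (filterᵇ smallestOdd (sublists (interval s m))) ≈[ N ] oddLeast s m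
  gf-smallestOdd s zero    = refl
  gf-smallestOdd s (suc m) = begin
    gf (filterᵇ smallestOdd (map (s ∷_) L ++ L))
      ≈⟨ reflexive (cong gf (Listₚ.filter-++ _ (map (s ∷_) L) L)) ⟩
    gf (filterᵇ smallestOdd (map (s ∷_) L) ++ filterᵇ smallestOdd L)
      ≈⟨ gf-++ (filterᵇ smallestOdd (map (s ∷_) L)) (filterᵇ smallestOdd L) ⟩
    gf (filterᵇ smallestOdd (map (s ∷_) L)) ⊕ gf (filterᵇ smallestOdd L)
      ≈⟨ +-cong (trans (reflexive (cong gf (filter-smallestOdd-map-∷ s L))) least) (gf-smallestOdd (suc s) m) ⟩
    oddLeast s (suc m) ∎
    where
    L = sublists (interval (suc s) m)
    least : gf (if s % 2 ≡ᵇ 1 then map (s ∷_) L else []) ≈[ N ] (if s % 2 ≡ᵇ 1 then X s ⊛ ∏ 1 (suc s) m else const 0ℤ)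
    least with s % 2 ≡ᵇ 1
    ... | true  = trans (gf-map-∷ s L) (*-congˡ {X s} (gf-sublists (suc s) m))
    ... | false = refl

  pdoSeries-coeff : pdoSeries N ≡ oddLeast 1 N N
  pdoSeries-coeff = ≡.trans (pdoSeries≡gf N) (coeff (gf-smallestOdd 1 N) N ℕₚ.≤-refl)

  thetaTail-coeff : thetaTail N ≡ ∑₁ θ N N
  thetaTail-coeff = ≡.trans (sumℤ-upTo-suc (λ k → θ (suc k) N) N)
    -- `infSum` runs up to k = N, that is to the exponent (N + 1)², which exceeds N and drops out.
    (≡.trans (cong₂ _+_ (≡.sym (∑₁-coeff θ N N)) (mono-off (sgn (suc N)) (ℕₚ.<⇒≢ (n≤n² (suc N)))))
             (ℤₚ.+-identityʳ _))

  -- `f` is left free because each coefficient of `pochInf` comes from its own finite product; only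
  -- agreement with the N-factor product up to q^N matters.
  truncated-identity : ∀ {f} → f ≈[ N ] poch (- 1ℤ) 1 1 N → (f ⊛ negVar phi) N ≡ (const 1ℤ ⊕ pdoSeries ⊕ thetaTail) N
  truncated-identity f≈ = ≡.trans
    (coeff (trans (*-cong (trans f≈ (poch≈∏ 1 1 N)) negVar-phi≈∑) (∏*∑≈oddLeast (negVar ∘ phiTerm) ∏*phiTerm)) N ℕₚ.≤-refl)
    (≡.sym (cong₂ (λ x y → const 1ℤ N + x + y) pdoSeries-coeff thetaTail-coeff))

pochInf-coeff : ∀ {i N} → i ≤ N → pochInf (- 1ℤ) 1 1 i ≡ poch (- 1ℤ) 1 1 N i
-- Stability is applied modulo q^{i+1}, not q^{N+1}: i factors already determine the i-th
-- coefficient, and the other N - i leave it unchanged.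
pochInf-coeff {i} {N} i≤N = ≡.trans (≡.sym (coeff (Mod.poch-stable i (N ∸ i)) i ℕₚ.≤-refl))
  (cong (λ n → poch (- 1ℤ) 1 1 n i) (ℕₚ.m+[n∸m]≡n i≤N))

theorem1p2 : (N : ℕ) →
    (pochInf (- 1ℤ) 1 1 ⊛ negVar phi) N ≡ (const 1ℤ ⊕ pdoSeries ⊕ thetaTail) N
theorem1p2 N = Mod.truncated-identity N (agree λ i i≤N → pochInf-coeff i≤N)
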